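{- Let $G$ be a bridgeless graph with $diam(G)=3$. If $G$ has an edge that is not contained in any triangle, then $rc(G)\leq 9$.
   Context: All graphs are finite, simple and undirected. $diam(G)=\max_{x,y\in V(G)} d(x,y)$, where $d(x,y)$ is the length of a shortest path between $x$ and $y$. A graph is bridgeless if it has no edge whose removal disconnects it. In an edge-colored graph (adjacent edges may share a color), a path is rainbow if no two of its edges have the same color. The rainbow connection number $rc(G)$ of a connected graph $G$ is the smallest $k$ for which there is an edge-coloring of $G$ with $k$ colors such that every pair of distinct vertices is joined by a rainbow path. -}

module Defs where

open import Data.Nat using (ℕ; zero; suc; _<_; _≤_)
open import Data.Fin using (Fin)
open import Data.List using (List; []; _∷_; length)
open import Data.List.Relation.Unary.Unique.Propositional using (Unique)
open import Data.Product using (Σ; ∃; ∃-syntax; _×_; _,_)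
open import Data.Sum using (_⊎_)
open import Relation.Binary.PropositionalEquality using (_≡_)
open import Relation.Nullary using (¬_)

record Graph (n : ℕ) : Set₁ where
  field
    Adj    : Fin n → Fin n → Set
    sym    : ∀ {x y} → Adj x y → Adj y x
    irrefl : ∀ {x} → ¬ Adj x x
open Graph public

data Walk {n : ℕ} (E : Fin n → Fin n → Set) : Fin n → Fin n → Set where
  [] : ∀ {x} → Walk E x x
  _∷_ : ∀ {x y z} → E x y → Walk E y z → Walk E x z

len : ∀ {n} {E : Fin n → Fin n → Set} {x y} → Walk E x y → ℕ
len [] = 0
len (_ ∷ w) = suc (len w)

verts : ∀ {n} {E : Fin n → Fin n → Set} {x y} → Walk E x y → List (Fin n)
verts {x = x} [] = x ∷ []
verts {x = x} (_ ∷ w) = x ∷ verts w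

IsPath : ∀ {n} {E : Fin n → Fin n → Set} {x y} → Walk E x y → Set
IsPath w = Unique (verts w)

IsDist : ∀ {n} → Graph n → Fin n → Fin n → ℕ → Set
IsDist G x y k =
  (Σ (Walk (Adj G) x y) λ p → IsPath p × len p ≡ k)
  × (∀ (p : Walk (Adj G) x y) → IsPath p → k ≤ len p)

Diam : ∀ {n} → Graph n → ℕ → Set
Diam {n} G d =
  (∀ (x y : Fin n) → ∃[ k ] (IsDist G x y k × k ≤ d))
  × (∃[ x ] ∃[ y ] IsDist G x y d)

Connected : ∀ {n} → (Fin n → Fin n → Set) → Set
Connected {n} E = ∀ (x y : Fin n) → Σ (Walk E x y) IsPath

deleteEdge : ∀ {n} → (Fin n → Fin n → Set) → Fin n → Fin n → Fin n → Fin n → Set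
deleteEdge E u v a b = E a b × ¬ ((a ≡ u × b ≡ v) ⊎ (a ≡ v × b ≡ u))

Bridgeless : ∀ {n} → Graph n → Set
Bridgeless G = Connected (Adj G)
  × (∀ u v → Adj G u v → Connected (deleteEdge (Adj G) u v))

NoTriangleEdge : ∀ {n} → Graph n → Set
NoTriangleEdge {n} G = ∃[ u ] ∃[ v ] (Adj G u v × ¬ (∃[ w ] (Adj G u w × Adj G v w)))

-- edge colouring with k colours (a colour for each unordered pair;
-- only the values on edges matter)
record EdgeColouring {n : ℕ} (G : Graph n) (k : ℕ) : Set where
  field
    col    : Fin n → Fin n → Fin k
    colSym : ∀ x y → col x y ≡ col y x
open EdgeColouring public

colours : ∀ {n k} {G : Graph n} (c : EdgeColouring G k) {x y} →
          Walk (Adj G) x y → List (Fin k)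
colours c [] = []
colours c (_∷_ {x} {y} _ w) = col c x y ∷ colours c w

IsRainbowPath : ∀ {n k} {G : Graph n} (c : EdgeColouring G k) {x y} →
                Walk (Adj G) x y → Set
IsRainbowPath c p = IsPath p × Unique (colours c p)

RainbowConnected : ∀ {n k} {G : Graph n} → EdgeColouring G k → Set
RainbowConnected {n} {G = G} c = ∀ (x y : Fin n) → ¬ x ≡ y →
  Σ (Walk (Adj G) x y) (IsRainbowPath c)

rc≤ : ∀ {n} → Graph n → ℕ → Set
rc≤ G k = Σ (EdgeColouring G k) RainbowConnected

module Submission where

-- Let u v be an edge in no triangle. Then N(u) and N(v) are disjoint, and as the diameter is 3 every
-- vertex is within distance 2 of both. The edge u v gets its own colour and each side four colours.
-- The edges are coloured by the kinds of their ends so that every vertex has several rainbow walks to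
-- u or v, with colour sets such that any two vertices have a disjoint pair of them. Bridgelessness
-- enters only through minimum degree 2: a vertex whose walks would all start with the same edge uses
-- another neighbour, and a maximal independent set decides which of the two gets which colour.

open import Data.Bool using (Bool; true; false; not)
open import Data.Bool.Properties using (not-involutive; not-¬) renaming (_≟_ to _≟ᵇ_)
open import Data.Fin using (Fin; zero; suc; join; splitAt)
open import Data.Fin.Patterns using (0F; 1F; 2F; 3F)
open import Data.Fin.Properties using (_≟_; any?; splitAt-join; suc-injective)
open import Data.List using (List; []; _∷_; map; _++_; _ʳ++_; allFin)
open import Data.List.Membership.Propositional using (_∈_; _∉_; find)
open import Data.List.Membership.Propositional.Properties using (∈-map⁻; ∈-allFin)
import Data.List.Membership.DecPropositional as DecMembership
open import Data.List.Properties using (map-cong; map-∘)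
open import Data.List.Relation.Binary.Disjoint.Propositional using (Disjoint)
open import Data.List.Relation.Binary.Sublist.Propositional using (_⊆_; _∷ʳ_; _∷_; []; ⊆-refl; ⊆-trans)
open import Data.List.Relation.Binary.Sublist.Propositional.Properties using (All-resp-⊆)
import Data.List.Relation.Binary.Subset.Propositional.Properties as Subset
open import Data.List.Relation.Unary.All using (All; []; _∷_; all?)
import Data.List.Relation.Unary.All as All
import Data.List.Relation.Unary.All.Properties as All
open import Data.List.Relation.Unary.AllPairs using ([]; _∷_)
open import Data.List.Relation.Unary.Any using (here; there)
import Data.List.Relation.Unary.Any as Any
open import Data.List.Relation.Unary.Unique.Propositional using (Unique)
open import Data.List.Relation.Unary.Unique.Propositional.Properties using (++⁺)
open import Data.Nat using (ℕ; suc; s≤s; _≤_)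
open import Data.Product using (Σ; ∃; ∃-syntax; _×_; _,_; proj₁; proj₂)
open import Data.Product.Properties using (≡-dec)
open import Data.Sum using (_⊎_; inj₁; inj₂; [_,_]′)
open import Data.Unit using (tt)
open import Function using (_∘_; id)
open import Relation.Binary.PropositionalEquality
  using (_≡_; _≢_; refl; trans; cong; cong₂; subst) renaming (sym to ≡-sym)
open import Relation.Nullary using (¬_; Dec; yes; no; contradiction)
open import Relation.Nullary.Decidable
  using (True; False; toWitness; toWitnessFalse; ¬?; _×-dec_; _⊎-dec_; map′)
open import Relation.Unary using (Decidable)
open import Defs

-- The obstacle is a pair of vertices that lie alike: their obvious walks to the roots use the same
-- colours. Vertices are therefore never compared directly. Each one only promises walks whose
-- colours stay in prescribed sets; the promises fall into eleven classes, and joining two vertices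
-- becomes a finite check on pairs of classes. Typically one of two similar vertices goes to its own
-- root in few colours, while the other goes to the opposite root in the remaining ones.
--
-- Of the four hues in a palette, the first serves the edges at a root and the second mainly the
-- edges from `mid` to `near` and from `far` to `both`. The third serves edges among near vertices,
-- edges from `both` to the layers `near` and `mid`, and edges that lead from `mid s` to `far` or to
-- the opposite `mid`. The fourth is kept for detours: edges inside `mid s` or among far vertices,
-- and a second choice of tint where `o1` or `o2` would collide.

pick : ∀ {P A : Set} → Dec P → A → A → A
pick (yes _) a b = a
pick (no _)  a b = b

pick-yes : ∀ {P A : Set} (d : Dec P) {a b : A} → P → pick d a b ≡ a
pick-yes (yes _) _ = refl
pick-yes (no ¬p) p = contradiction p ¬p

pick-no : ∀ {P A : Set} (d : Dec P) {a b : A} → ¬ P → pick d a b ≡ b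
pick-no (yes p) ¬p = contradiction p ¬p
pick-no (no _)  _  = refl

unique-⊆ : ∀ {A : Set} {xs ys : List A} → xs ⊆ ys → Unique ys → Unique xs
unique-⊆ []         []       = []
unique-⊆ (_ ∷ʳ s)   (_ ∷ u)  = unique-⊆ s u
unique-⊆ (refl ∷ s) (a ∷ u)  = All-resp-⊆ s a ∷ unique-⊆ s u

unique-ʳ++ : ∀ {A : Set} {xs ys : List A} →
             Unique xs → Unique ys → Disjoint xs ys → Unique (xs ʳ++ ys)
unique-ʳ++ []      u _ = u
unique-ʳ++ {xs = x ∷ xs} (a ∷ v) u d =
  unique-ʳ++ v (All.¬Any⇒All¬ _ (λ i → d (here refl , i)) ∷ u)
    λ { (i , here refl) → All.lookup a i refl ; (i , there j) → d (there i , j) }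

all-ʳ++ : ∀ {A : Set} {P : A → Set} {xs ys : List A} → All P xs → All P ys → All P (xs ʳ++ ys)
all-ʳ++ []       qs = qs
all-ʳ++ (p ∷ ps) qs = all-ʳ++ ps (p ∷ qs)

-- Rainbow walks

module _ {n k : ℕ} {G : Graph n} (c : EdgeColouring G k) where

  open DecMembership (_≟_ {n}) using (_∈?_)

  suffixFrom : ∀ {x y z} (w : Walk (Adj G) x y) → IsPath w → z ∈ verts w →
               Σ (Walk (Adj G) z y) λ w′ → IsPath w′ × colours c w′ ⊆ colours c w
  suffixFrom []      p       (here refl) = [] , p , []
  suffixFrom (e ∷ w) p       (here refl) = e ∷ w , p , ⊆-refl
  suffixFrom (e ∷ w) (_ ∷ p) (there i)   with suffixFrom w p i
  ... | w′ , p′ , s = w′ , p′ , (_ ∷ʳ s)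

  -- Loop erasure keeps a sublist of the colours, so rainbow walks suffice everywhere below and
  -- vertices may repeat.
  toPath : ∀ {x y} (w : Walk (Adj G) x y) →
           Σ (Walk (Adj G) x y) λ w′ → IsPath w′ × colours c w′ ⊆ colours c w
  toPath [] = [] , [] ∷ [] , []
  toPath (_∷_ {x} e w) with toPath w
  ... | w′ , p , s with x ∈? verts w′
  ...   | no x∉w′ = e ∷ w′ , All.¬Any⇒All¬ _ x∉w′ ∷ p , refl ∷ s
  ...   | yes x∈w′ with suffixFrom w′ p x∈w′
  ...     | w″ , p″ , s″ = w″ , p″ , (_ ∷ʳ ⊆-trans s″ s)

  rainbowPath : ∀ {x y} (w : Walk (Adj G) x y) → Unique (colours c w) →
                Σ (Walk (Adj G) x y) (IsRainbowPath c)
  rainbowPath w u with toPath w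
  ... | w′ , p , s = w′ , p , unique-⊆ s u

  _⧺_ : ∀ {x y z} → Walk (Adj G) x y → Walk (Adj G) y z → Walk (Adj G) x z
  []      ⧺ w′ = w′
  (e ∷ w) ⧺ w′ = e ∷ (w ⧺ w′)

  colours-⧺ : ∀ {x y z} (w : Walk (Adj G) x y) (w′ : Walk (Adj G) y z) →
              colours c (w ⧺ w′) ≡ colours c w ++ colours c w′
  colours-⧺ []      w′ = refl
  colours-⧺ (e ∷ w) w′ = cong (_ ∷_) (colours-⧺ w w′)

  backwards : ∀ {x y z} → Walk (Adj G) x y → Walk (Adj G) x z → Walk (Adj G) y z
  backwards []      acc = acc
  backwards (e ∷ w) acc = backwards w (Graph.sym G e ∷ acc)

  colours-backwards : ∀ {x y z} (w : Walk (Adj G) x y) (acc : Walk (Adj G) x z) →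
                      colours c (backwards w acc) ≡ colours c w ʳ++ colours c acc
  colours-backwards []      acc = refl
  colours-backwards (_∷_ {x} {y} e w) acc =
    trans (colours-backwards w (Graph.sym G e ∷ acc))
          (cong (λ t → colours c w ʳ++ (t ∷ colours c acc)) (colSym c y x))

-- Domination

module _ {n : ℕ} (_~_ : Fin n → Fin n → Set) (_~?_ : ∀ p q → Dec (p ~ q))
         (~-sym : ∀ {p q} → p ~ q → q ~ p) (~-irrefl : ∀ {p} → ¬ (p ~ p)) where

  open DecMembership (_≟_ {n}) using (_∈?_)

  -- Greedy choice from the end of the list. Maximality is claimed only for members of `xs`, which
  -- makes the induction work.
  maximalIndependent : {P : Fin n → Set} → Decidable P → (xs : List (Fin n)) →
    ∃ λ (T : List (Fin n)) → (∀ {p} → p ∈ T → P p) × (∀ {p q} → p ∈ T → q ∈ T → ¬ (p ~ q)) ×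
      (∀ {p} → p ∈ xs → P p → p ∈ T ⊎ ∃ λ q → q ∈ T × p ~ q)
  maximalIndependent P? [] = [] , (λ ()) , (λ ()) , λ ()
  maximalIndependent P? (x ∷ xs) with maximalIndependent P? xs
  ... | T , T⊆P , indep , max with P? x | any? (λ q → (q ∈? T) ×-dec (x ~? q))
  ...   | no ¬Px | _ = T , T⊆P , indep ,
          λ { (here refl) Px → contradiction Px ¬Px ; (there i) → max i }
  ...   | yes _ | yes dominated = T , T⊆P , indep ,
          λ { (here refl) _ → inj₂ dominated ; (there i) → max i }
  ...   | yes Px | no free = x ∷ T ,
          (λ { (here refl) → Px ; (there i) → T⊆P i }) ,
          (λ { (here refl) (here refl) → ~-irrefl
             ; (here refl) (there j) x~q → free (_ , j , x~q)
             ; (there i) (here refl) p~x → free (_ , i , ~-sym p~x)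
             ; (there i) (there j) → indep i j }) ,
          λ { (here refl) _ → inj₁ (here refl)
            ; (there i) Pp → [ inj₁ ∘ there , (λ { (q , j , e) → inj₂ (q , there j , e) }) ]′ (max i Pp) }

  -- A two-colouring of L in which every vertex of L has a neighbour that is differently coloured or
  -- lies in W but outside L.
  record Splitting (L W : Fin n → Set) : Set₁ where
    field
      T     : Fin n → Set
      T?    : Decidable T
      T⊆L   : ∀ {p} → T p → L p
      inner : ∀ {p} → T p → ∃ λ q → p ~ q × L q × ¬ T q
      outer : ∀ {p} → L p → ¬ T p → ∃ λ q → p ~ q × W q × (T q ⊎ ¬ L q)

  splitting : {L W : Fin n → Set} → Decidable L → Decidable W → (∀ {p} → L p → W p) →
              (∀ {p} → L p → ∃ λ q → p ~ q × W q) → Splitting L W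
  splitting {L} {W} L? W? L⊆W nbr = record
    { T = _∈ T ; T? = _∈? T ; T⊆L = λ i → proj₁ (T⊆ i) ; inner = inner ; outer = outer }
    where
    -- A maximal independent set among the vertices whose W-neighbours are all in L is enough: the
    -- other vertices of L have a neighbour outside L anyway.
    Exit : Fin n → Set
    Exit p = ∃ λ q → p ~ q × W q × ¬ L q
    exit? : Decidable Exit
    exit? p = any? λ q → (p ~? q) ×-dec W? q ×-dec ¬? (L? q)
    mis = maximalIndependent (λ p → L? p ×-dec ¬? (exit? p)) (allFin n)
    T = proj₁ mis
    T⊆ = proj₁ (proj₂ mis)
    inner : ∀ {p} → p ∈ T → ∃ λ q → p ~ q × L q × q ∉ T
    inner {p} i with T⊆ i
    ... | Lp , noExit with nbr Lp
    ...   | q , p~q , Wq with L? q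
    -- Having no exit puts the neighbour in `L`; independence then keeps it out of `T`.
    ...     | yes Lq = q , p~q , Lq , λ j → proj₁ (proj₂ (proj₂ mis)) i j p~q
    ...     | no ¬Lq = contradiction (q , p~q , Wq , ¬Lq) noExit
    outer : ∀ {p} → L p → p ∉ T → ∃ λ q → p ~ q × W q × (q ∈ T ⊎ ¬ L q)
    outer {p} Lp p∉T with exit? p
    ... | yes (q , p~q , Wq , ¬Lq) = q , p~q , Wq , inj₂ ¬Lq
    ... | no noExit with proj₂ (proj₂ (proj₂ mis)) (∈-allFin p) (Lp , noExit)
    ...   | inj₁ p∈T = contradiction p∈T p∉T
    ...   | inj₂ (q , q∈T , p~q) = q , p~q , L⊆W (proj₁ (T⊆ q∈T)) , inj₁ q∈T

-- Tints

Tint : Set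
Tint = Bool × Fin 4

-- Relative to a side: o is the palette of that side, p that of the opposite side.
pattern o1 = true , 0F
pattern o2 = true , 1F
pattern o3 = true , 2F
pattern o4 = true , 3F
pattern p1 = false , 0F
pattern p2 = false , 1F
pattern p3 = false , 2F
pattern p4 = false , 3F

_≟ᵗ_ : (k l : Tint) → Dec (k ≡ l)
_≟ᵗ_ = ≡-dec _≟ᵇ_ _≟_

open DecMembership _≟ᵗ_ using () renaming (_∈?_ to _∈ᵗ?_)

rel : Bool → Bool → Bool
rel s true  = s
rel s false = not s

half : Bool → Fin 4 → Fin 4 ⊎ Fin 4
half false = inj₁
half true  = inj₂

-- Colour 0 is reserved for the edge in no triangle.
paint : Bool → Tint → Fin 9
paint s (b , h) = suc (join 4 4 (half (rel s b) h))

opposite : Tint → Tint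
opposite (b , h) = not b , h

half-injective : ∀ {b b′ h h′} → half b h ≡ half b′ h′ → b ≡ b′ × h ≡ h′
half-injective {false} {false} refl = refl , refl
half-injective {true}  {true}  refl = refl , refl

rel-injective : ∀ s {b b′} → rel s b ≡ rel s b′ → b ≡ b′
rel-injective s     {false} {false} _ = refl
rel-injective s     {true}  {true}  _ = refl
rel-injective false {false} {true}  ()
rel-injective true  {false} {true}  ()
rel-injective false {true}  {false} ()
rel-injective true  {true}  {false} ()

paint-injective : ∀ s {k l} → paint s k ≡ paint s l → k ≡ l
paint-injective s {b , h} {b′ , h′} e
  with half-injective (trans (≡-sym (splitAt-join 4 4 _)) (trans (cong (splitAt 4) (suc-injective e)) (splitAt-join 4 4 _)))
... | eb , eh = cong₂ _,_ (rel-injective s eb) eh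

rel-not : ∀ s b → rel (not s) b ≡ rel s (not b)
rel-not s true  = refl
rel-not s false = not-involutive s

paint-not : ∀ s k → paint (not s) k ≡ paint s (opposite k)
paint-not s (b , h) = cong (λ b → suc (join 4 4 (half b h))) (rel-not s b)

-- The third colours cannot be used symmetrically: edges between the two neighbourhoods need one of
-- them, edges within either neighbourhood the other, so their relative tints depend on s.
thirdTints : ∀ s → ∃ λ b → paint true p3 ≡ paint s (b , 2F) × paint true o3 ≡ paint s (not b , 2F)
thirdTints true  = false , refl , refl
thirdTints false = true , refl , refl

-- An entry (t , M) of caps promises a rainbow walk with tints in M, ending at the root of the own
-- (t = true) or the opposite side. Two vertices with disjoint entries are joined through the roots,
-- if necessary along the edge of colour 0.
data Class : Set where
  atRoot nearI nearT nearN midI midII midIII both far farLone farLone′ : Class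

Mask : Set
Mask = List Tint

caps : Class → List (Bool × Mask)
caps atRoot   = (true , []) ∷ []
caps nearI    = (true , o1 ∷ []) ∷ (false , o2 ∷ o3 ∷ o4 ∷ p1 ∷ p2 ∷ p3 ∷ p4 ∷ []) ∷ []
caps nearT    = (true , o1 ∷ []) ∷ (true , o3 ∷ p3 ∷ o4 ∷ []) ∷ []
caps nearN    = (true , o4 ∷ []) ∷ (true , o3 ∷ p3 ∷ o1 ∷ []) ∷ []
caps midI     = (true , o2 ∷ o1 ∷ []) ∷ (false , o3 ∷ p1 ∷ p2 ∷ p3 ∷ p4 ∷ []) ∷ []
-- The second entry lists both `o2` and `o4`, because the neighbour it passes through may continue
-- with either.
caps midII    = (true , p2 ∷ o1 ∷ []) ∷ (true , p4 ∷ o2 ∷ o4 ∷ o1 ∷ []) ∷ (false , p2 ∷ o3 ∷ p3 ∷ p1 ∷ []) ∷ []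
caps midIII   = (true , o4 ∷ o1 ∷ []) ∷ (true , p4 ∷ o2 ∷ o1 ∷ []) ∷ (false , p4 ∷ o2 ∷ o3 ∷ p3 ∷ p1 ∷ []) ∷ []
caps both     = (true , o3 ∷ o1 ∷ []) ∷ (false , p3 ∷ p1 ∷ []) ∷ []
caps far      = (true , o1 ∷ o2 ∷ o3 ∷ []) ∷ (false , p1 ∷ p2 ∷ p3 ∷ []) ∷ []
caps farLone  = (true , o1 ∷ o2 ∷ o3 ∷ []) ∷ (false , o4 ∷ p1 ∷ p2 ∷ p3 ∷ []) ∷ (false , o2 ∷ p3 ∷ p1 ∷ []) ∷ []
caps farLone′ = (true , o1 ∷ o2 ∷ o3 ∷ []) ∷ (false , p4 ∷ p1 ∷ p2 ∷ p3 ∷ []) ∷ (false , o2 ∷ p3 ∷ p1 ∷ []) ∷ []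

classes : List Class
classes = atRoot ∷ nearI ∷ nearT ∷ nearN ∷ midI ∷ midII ∷ midIII ∷ both ∷ far ∷ farLone ∷ farLone′ ∷ []

∈-classes : ∀ κ → κ ∈ classes
∈-classes atRoot   = here refl
∈-classes nearI    = there (here refl)
∈-classes nearT    = there (there (here refl))
∈-classes nearN    = there (there (there (here refl)))
∈-classes midI     = there (there (there (there (here refl))))
∈-classes midII    = there (there (there (there (there (here refl)))))
∈-classes midIII   = there (there (there (there (there (there (here refl))))))
∈-classes both     = there (there (there (there (there (there (there (here refl)))))))
∈-classes far      = there (there (there (there (there (there (there (there (here refl))))))))
∈-classes farLone  = there (there (there (there (there (there (there (there (there (here refl)))))))))
∈-classes farLone′ = there (there (there (there (there (there (there (there (there (there (here refl))))))))))

fromSide : Bool → Bool × Mask → Bool × Mask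
fromSide true  c       = c
fromSide false (t , M) = not t , map opposite M

Compatible : List (Bool × Mask) → List (Bool × Mask) → Set
Compatible cs ds = Any.Any (λ c → Any.Any (λ d → All (_∉ proj₂ d) (proj₂ c)) ds) cs

compatible? : ∀ cs ds → Dec (Compatible cs ds)
compatible? cs ds = Any.any? (λ c → Any.any? (λ d → all? (λ k → ¬? (k ∈ᵗ? proj₂ d)) (proj₂ c)) ds) cs

-- Settled by evaluating all pairs of classes, on equal and on opposite sides. Two vertices of the
-- same class and side make the same promises, which is why every class but `atRoot` has at least
-- two entries.
compatible : ∀ b κ κ′ → Compatible (caps κ) (map (fromSide b) (caps κ′))
compatible b κ κ′ = All.lookup (All.lookup (table b) (∈-classes κ)) (∈-classes κ′)
  where
  Table : Bool → Set
  Table b = All (λ κ → All (λ κ′ → Compatible (caps κ) (map (fromSide b) (caps κ′))) classes) classes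
  table? : ∀ b → Dec (Table b)
  table? b = all? (λ κ → all? (λ κ′ → compatible? (caps κ) (map (fromSide b) (caps κ′))) classes) classes
  table : ∀ b → Table b
  table true  = toWitness {a? = table? true} tt
  table false = toWitness {a? = table? false} tt

-- For the two ends of the triangle-free edge: near s is the neighbourhood of the end on side s; other
-- vertices are classified by which of the two neighbourhoods they are adjacent to.
data Kind : Set where
  core near mid : Bool → Kind
  both far      : Kind

-- The kinds of vertices and their possible neighbours

module Frame {n : ℕ} (G : Graph n)
  (_~?_ : ∀ p q → Dec (Adj G p q))
  (close : ∀ p q → p ≡ q ⊎ Adj G p q ⊎ (∃ λ x → Adj G p x × Adj G x q) ⊎
                   ∃ λ x → ∃ λ y → Adj G p x × Adj G x y × Adj G y q)
  (another : ∀ {p q} → Adj G p q → ∃ λ r → Adj G p r × r ≢ q)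
  (root : Bool → Fin n)
  (root~ : ∀ s → Adj G (root s) (root (not s)))
  (noTriangle : ∀ s {w} → Adj G (root s) w → ¬ Adj G (root (not s)) w)
  where

  V : Set
  V = Fin n

  _~_ : V → V → Set
  _~_ = Adj G

  ~-sym : ∀ {p q} → p ~ q → q ~ p
  ~-sym = Graph.sym G

  record Near (s : Bool) (x : V) : Set where
    constructor _,_
    field
      adj : root s ~ x
      new : x ≢ root (not s)

  near? : ∀ s → Decidable (Near s)
  near? s x = map′ (λ (e , f) → e , f) (λ (e , f) → e , f)
                   ((root s ~? x) ×-dec ¬? (x ≟ root (not s)))

  Touch : Bool → V → Set
  Touch s p = ∃ λ x → p ~ x × Near s x

  touch? : ∀ s → Decidable (Touch s)
  touch? s p = any? λ x → (p ~? x) ×-dec near? s x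

  Off : V → Set
  Off p = ∀ s → p ≢ root s × ¬ Near s p

  data Is : Kind → V → Set where
    core : ∀ s → Is (core s) (root s)
    near : ∀ {s x} → Near s x → Is (near s) x
    mid  : ∀ {s p} → Off p → Touch s p → ¬ Touch (not s) p → Is (mid s) p
    both : ∀ {p} → Off p → (∀ s → Touch s p) → Is both p
    far  : ∀ {p} → Off p → (∀ s → ¬ Touch s p) → Is far p

  abstract
    kindOf : ∀ p → ∃ λ k → Is k p
    kindOf p with p ≟ root false | p ≟ root true | near? false p | near? true p
    ... | yes refl | _        | _     | _     = _ , core false
    ... | no _     | yes refl | _     | _     = _ , core true
    ... | no _     | no _     | yes x | _     = _ , near x
    ... | no _     | no _     | no _  | yes x = _ , near x
    ... | no a     | no b     | no c  | no d  = rest (touch? false p) (touch? true p)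
      where
      off : Off p
      off false = a , c
      off true  = b , d
      rest : Dec (Touch false p) → Dec (Touch true p) → ∃ λ k → Is k p
      rest (yes t) (yes t′) = _ , both off λ { false → t ; true → t′ }
      rest (yes t) (no t′)  = _ , mid {false} off t t′
      rest (no t)  (yes t′) = _ , mid {true} off t′ t
      rest (no t)  (no t′)  = _ , far off λ { false → t ; true → t′ }

  sides : ∀ s s′ → s ≡ s′ ⊎ s′ ≡ not s
  sides false false = inj₁ refl
  sides false true  = inj₂ refl
  sides true  false = inj₂ refl
  sides true  true  = inj₁ refl

  core≡ : ∀ {k s} → Is k (root s) → k ≡ core s
  core≡ {s = s} i = go i refl
    where
    go : ∀ {k p} → Is k p → p ≡ root s → k ≡ core s
    go (core s′) e with sides s s′
    ... | inj₁ refl = refl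
    ... | inj₂ refl = contradiction (subst (root s ~_) e (root~ s)) (irrefl G)
    go (near {s′} (r~ , new)) refl with sides s s′
    ... | inj₁ refl = contradiction r~ (irrefl G)
    ... | inj₂ refl = contradiction (cong root (≡-sym (not-involutive s))) new
    go (mid off _ _)  e = contradiction e (proj₁ (off s))
    go (both off _)   e = contradiction e (proj₁ (off s))
    go (far off _)    e = contradiction e (proj₁ (off s))

  -- The two neighbourhoods are disjoint because the edge between the roots lies in no triangle.
  near≡ : ∀ {k s x} → Is k x → Near s x → k ≡ near s
  near≡ {s = s} (core s′) x with core≡ (near x)
  ... | ()
  near≡ {s = s} (near {s′} (r~ , _)) (r~′ , _) with sides s s′
  ... | inj₁ refl = refl
  ... | inj₂ refl = contradiction r~ (noTriangle s r~′)
  near≡ {s = s} (mid off _ _) x = contradiction x (proj₂ (off s))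
  near≡ {s = s} (both off _)  x = contradiction x (proj₂ (off s))
  near≡ {s = s} (far off _)   x = contradiction x (proj₂ (off s))

  -- The colouring is computed from `kindOf`; uniqueness lets any proof of `Is k p` evaluate it.
  kind-unique : ∀ {k k′ p} → Is k p → Is k′ p → k ≡ k′
  kind-unique i (core s) = core≡ i
  kind-unique i (near x) = near≡ i x
  kind-unique (core s) j = ≡-sym (core≡ j)
  kind-unique (near x) j = ≡-sym (near≡ j x)
  kind-unique (mid {s} _ t t′) (mid {s′} _ u u′) with sides s s′
  ... | inj₁ refl = refl
  ... | inj₂ refl = contradiction u t′
  kind-unique (mid {s} _ t t′) (both _ u) = contradiction (u (not s)) t′
  kind-unique (mid {s} _ t t′) (far _ u)  = contradiction t (u s)
  kind-unique (both _ t) (mid {s} _ u u′) = contradiction (t (not s)) u′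
  kind-unique (both _ t) (both _ u)       = refl
  kind-unique (both _ t) (far _ u)        = contradiction (t true) (u true)
  kind-unique (far _ t)  (mid {s} _ u u′) = contradiction u (t s)
  kind-unique (far _ t)  (both _ u)       = contradiction (u true) (t true)
  kind-unique (far _ t)  (far _ u)        = refl

  kind : V → Kind
  kind p = proj₁ (kindOf p)

  kind-is : ∀ {k p} → Is k p → kind p ≡ k
  kind-is i = kind-unique (proj₂ (kindOf _)) i

  _≟ᵏ_ : (k k′ : Kind) → Dec (k ≡ k′)
  core s ≟ᵏ core s′ = map′ (cong core) (λ { refl → refl }) (s ≟ᵇ s′)
  core _ ≟ᵏ near _  = no λ ()
  core _ ≟ᵏ mid _   = no λ ()
  core _ ≟ᵏ both    = no λ ()
  core _ ≟ᵏ far     = no λ ()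
  near _ ≟ᵏ core _  = no λ ()
  near s ≟ᵏ near s′ = map′ (cong near) (λ { refl → refl }) (s ≟ᵇ s′)
  near _ ≟ᵏ mid _   = no λ ()
  near _ ≟ᵏ both    = no λ ()
  near _ ≟ᵏ far     = no λ ()
  mid _  ≟ᵏ core _  = no λ ()
  mid _  ≟ᵏ near _  = no λ ()
  mid s  ≟ᵏ mid s′  = map′ (cong mid) (λ { refl → refl }) (s ≟ᵇ s′)
  mid _  ≟ᵏ both    = no λ ()
  mid _  ≟ᵏ far     = no λ ()
  both   ≟ᵏ core _  = no λ ()
  both   ≟ᵏ near _  = no λ ()
  both   ≟ᵏ mid _   = no λ ()
  both   ≟ᵏ both    = yes refl
  both   ≟ᵏ far     = no λ ()
  far    ≟ᵏ core _  = no λ ()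
  far    ≟ᵏ near _  = no λ ()
  far    ≟ᵏ mid _   = no λ ()
  far    ≟ᵏ both    = no λ ()
  far    ≟ᵏ far     = yes refl

  abstract
    is? : ∀ k → Decidable (Is k)
    is? k p = map′ (λ e → subst (λ k → Is k p) e (proj₂ (kindOf p))) kind-is (kind p ≟ᵏ k)

  Next : Kind → V → Set
  Next k p = ∃ λ q → p ~ q × Is k q

  abstract
    next? : ∀ k → Decidable (Next k)
    next? k p = any? λ q → (p ~? q) ×-dec is? k q

  root-nbr : ∀ s {p} → root s ~ p → Near s p ⊎ p ≡ root (not s)
  root-nbr s {p} e with p ≟ root (not s)
  ... | yes eq = inj₂ eq
  ... | no ne  = inj₁ (e , ne)

  off-root : ∀ {p} s → Off p → ¬ (p ~ root s)
  off-root s off e with root-nbr s (~-sym e)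
  ... | inj₁ x  = proj₂ (off s) x
  ... | inj₂ eq = proj₁ (off (not s)) eq

  not² : ∀ {k : Bool → Kind} {s p} → Is (k s) p → Is (k (not (not s))) p
  not² {k} {s} {p} = subst (λ t → Is (k t) p) (≡-sym (not-involutive s))

  near-nbr : ∀ {s x q} → Is (near s) x → x ~ q →
             q ≡ root s ⊎ Is (near s) q ⊎ Is (near (not s)) q ⊎ Is (mid s) q ⊎ Is both q
  near-nbr {s} {x} {q} (near nx) e with kindOf q
  ... | _ , core s′ with sides s s′
  ...   | inj₁ refl = inj₁ refl
  ...   | inj₂ refl = contradiction (~-sym e) (noTriangle s (Near.adj nx))
  near-nbr {s} (near nx) e | _ , near {s′} y with sides s s′
  ...   | inj₁ refl = inj₂ (inj₁ (near y))
  ...   | inj₂ refl = inj₂ (inj₂ (inj₁ (near y)))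
  near-nbr {s} (near nx) e | _ , mid {s′} o t t′ with sides s s′
  ...   | inj₁ refl = inj₂ (inj₂ (inj₂ (inj₁ (mid o t t′))))
  ...   | inj₂ refl = contradiction (_ , ~-sym e , subst (λ s → Near s _) (≡-sym (not-involutive s)) nx) t′
  near-nbr {s} (near nx) e | _ , both o t = inj₂ (inj₂ (inj₂ (inj₂ (both o t))))
  near-nbr {s} (near nx) e | _ , far o t  = contradiction (_ , ~-sym e , nx) (t s)

  mid-nbr : ∀ {s a q} → Is (mid s) a → a ~ q →
            Is (near s) q ⊎ Is (mid s) q ⊎ Is (mid (not s)) q ⊎ Is both q ⊎ Is far q
  mid-nbr {s} {a} {q} (mid o t t′) e with kindOf q
  ... | _ , core s′ = contradiction e (off-root s′ o)
  ... | _ , near {s′} x with sides s s′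
  ...   | inj₁ refl = inj₁ (near x)
  ...   | inj₂ refl = contradiction (_ , e , x) t′
  mid-nbr {s} (mid _ _ _) e | _ , mid {s′} o t t′ with sides s s′
  ...   | inj₁ refl = inj₂ (inj₁ (mid o t t′))
  ...   | inj₂ refl = inj₂ (inj₂ (inj₁ (mid o t t′)))
  mid-nbr (mid _ _ _) e | _ , both o t = inj₂ (inj₂ (inj₂ (inj₁ (both o t))))
  mid-nbr (mid _ _ _) e | _ , far o t  = inj₂ (inj₂ (inj₂ (inj₂ (far o t))))

  far-nbr : ∀ {z q} → Is far z → z ~ q → (∃ λ s → Is (mid s) q) ⊎ Is both q ⊎ Is far q
  far-nbr {q = q} (far o ¬t) e with kindOf q
  ... | _ , core s     = contradiction e (off-root s o)
  ... | _ , near {s} x = contradiction (_ , e , x) (¬t s)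
  ... | _ , mid {s} p t t′ = inj₁ (s , mid p t t′)
  ... | _ , both p t   = inj₂ (inj₁ (both p t))
  ... | _ , far p t    = inj₂ (inj₂ (far p t))

  -- `z` is adjacent to no root and to no near vertex, so a walk of at most three edges to `root s`
  -- has exactly three, and its last inner vertex is near `root s`. The first inner vertex then
  -- touches side `s`.
  far-inward : ∀ s {z} → Is far z → Next (mid s) z ⊎ Next both z
  far-inward s {z} (far o ¬t) with close z (root s)
  ... | inj₁ e = contradiction e (proj₁ (o s))
  ... | inj₂ (inj₁ e) = contradiction e (off-root s o)
  ... | inj₂ (inj₂ (inj₁ (x , z~x , x~r))) with root-nbr s (~-sym x~r)
  ...   | inj₁ nx   = contradiction (x , z~x , nx) (¬t s)
  ...   | inj₂ refl = contradiction z~x (off-root (not s) o)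
  far-inward s {z} (far o ¬t) | inj₂ (inj₂ (inj₂ (x , y , z~x , x~y , y~r))) with root-nbr s (~-sym y~r)
  ...   | inj₂ refl with root-nbr (not s) (~-sym x~y)
  ...     | inj₁ nx = contradiction (x , z~x , nx) (¬t (not s))
  ...     | inj₂ refl = contradiction z~x (off-root (not (not s)) o)
  far-inward s {z} (far o ¬t) | inj₂ (inj₂ (inj₂ (x , y , z~x , x~y , y~r)))
        | inj₁ ny with kindOf x
  ...     | _ , core s′ = contradiction z~x (off-root s′ o)
  ...     | _ , near {s′} nx = contradiction (x , z~x , nx) (¬t s′)
  ...     | _ , far _ t = contradiction (y , x~y , ny) (t s)
  ...     | _ , both p t = inj₂ (x , z~x , both p t)
  ...     | _ , mid {s′} p t t′ with sides s s′
  ...       | inj₁ refl = inj₁ (x , z~x , mid p t t′)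
  ...       | inj₂ refl = contradiction (y , x~y , subst (λ s → Near s y) (≡-sym (not-involutive s)) ny) t′

  -- Vertices whose walks would start with the same edge

  inhabited : ∀ s → ∃ (Near s)
  inhabited s with another (root~ s)
  ... | x , e , ne = x , e , ne

  -- A good vertex reaches the opposite root with tints among `o3`, `p3`, `p1` (`good-opp`), so an
  -- edge of tint `o2` or `p2` may precede that walk. `Outside` means a neighbour other than the
  -- root and the vertices of the own neighbourhood, by `near-nbr`.
  Crossing Good Outside : Bool → V → Set
  Crossing s = Next (near (not s))
  Good s x = Crossing s x ⊎ Next both x ⊎ ∃ λ x′ → x ~ x′ × Is (near s) x′ × Crossing s x′
  Outside s x = Crossing s x ⊎ Next both x ⊎ Next (mid s) x

  -- An ordinary vertex gets to the opposite root without `o1` and `o2`, hence can use `o2` on all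
  -- its near edges. Any other `mid s` vertex has all its neighbours in `near s` and `mid s`. It is
  -- `Lone` if it has exactly one near neighbour and that one is good, so that both direct walks
  -- share their first edge.
  GoodNbr Several Leaving Ordinary Lone : Bool → V → Set
  GoodNbr s a = ∃ λ x → a ~ x × Is (near s) x × Good s x
  Several s a = ∃ λ x → ∃ λ x′ → x ≢ x′ × (a ~ x × Is (near s) x) × (a ~ x′ × Is (near s) x′)
  Leaving s a = Next both a ⊎ Next (mid (not s)) a
  Ordinary s a = Leaving s a ⊎ Next far a ⊎ ∃ λ a′ → a ~ a′ × Is (mid s) a′ × Leaving s a′
  Lone s a = Is (mid s) a × ¬ Ordinary s a × GoodNbr s a × ¬ Several s a

  abstract
    crossing? : ∀ s → Decidable (Crossing s)
    crossing? s = next? (near (not s))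
    good? : ∀ s → Decidable (Good s)
    good? s x = crossing? s x ⊎-dec next? both x ⊎-dec
                any? λ x′ → (x ~? x′) ×-dec is? (near s) x′ ×-dec crossing? s x′
    outside? : ∀ s → Decidable (Outside s)
    outside? s x = crossing? s x ⊎-dec next? both x ⊎-dec next? (mid s) x
    goodNbr? : ∀ s → Decidable (GoodNbr s)
    goodNbr? s a = any? λ x → (a ~? x) ×-dec is? (near s) x ×-dec good? s x
    several? : ∀ s → Decidable (Several s)
    several? s a = any? λ x → any? λ x′ → ¬? (x ≟ x′) ×-dec
      ((a ~? x) ×-dec is? (near s) x) ×-dec ((a ~? x′) ×-dec is? (near s) x′)
    leaving? : ∀ s → Decidable (Leaving s)
    leaving? s a = next? both a ⊎-dec next? (mid (not s)) a
    ordinary? : ∀ s → Decidable (Ordinary s)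
    ordinary? s a = leaving? s a ⊎-dec next? far a ⊎-dec
      any? λ a′ → (a ~? a′) ×-dec is? (mid s) a′ ×-dec leaving? s a′
    lone? : ∀ s → Decidable (Lone s)
    lone? s a = is? (mid s) a ×-dec ¬? (ordinary? s a) ×-dec goodNbr? s a ×-dec ¬? (several? s a)

  -- A second neighbour exists by minimum degree 2; a near one would contradict `¬ Several`, and any
  -- kind besides `mid s` would make `a` ordinary.
  lone-nbr : ∀ {s a} → Lone s a → ∃ λ a′ → a ~ a′ × Is (mid s) a′
  lone-nbr (ia , ¬ord , (g , a~g , ig , _) , ¬sev) with another a~g
  ... | q , a~q , q≢g with mid-nbr ia a~q
  ...   | inj₁ iq = contradiction (q , g , q≢g , (a~q , iq) , (a~g , ig)) ¬sev
  ...   | inj₂ (inj₁ iq) = q , a~q , iq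
  ...   | inj₂ (inj₂ (inj₁ iq)) = contradiction (inj₁ (inj₂ (q , a~q , iq))) ¬ord
  ...   | inj₂ (inj₂ (inj₂ (inj₁ iq))) = contradiction (inj₁ (inj₁ (q , a~q , iq))) ¬ord
  ...   | inj₂ (inj₂ (inj₂ (inj₂ iq))) = contradiction (inj₂ (inj₁ (q , a~q , iq))) ¬ord

  abstract
    midSplit : ∀ s → Splitting _~_ _~?_ ~-sym (irrefl G) (Lone s) (Is (mid s))
    midSplit s = splitting _~_ _~?_ ~-sym (irrefl G) (lone? s) (is? (mid s)) proj₁ lone-nbr

  module MidSplit (s : Bool) = Splitting (midSplit s)

  Alone : Bool → V → Set
  Alone s x = Is (near s) x × ¬ Outside s x

  alone-nbr : ∀ {s x} → Alone s x → ∃ λ x′ → x ~ x′ × Is (near s) x′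
  alone-nbr {s} (ix@(near nx) , ¬out) with another (~-sym (Near.adj nx))
  ... | q , x~q , q≢r with near-nbr ix x~q
  ...   | inj₁ q≡r = contradiction q≡r q≢r
  ...   | inj₂ (inj₁ iq) = q , x~q , iq
  ...   | inj₂ (inj₂ (inj₁ iq)) = contradiction (inj₁ (q , x~q , iq)) ¬out
  ...   | inj₂ (inj₂ (inj₂ (inj₁ iq))) = contradiction (inj₂ (inj₂ (q , x~q , iq))) ¬out
  ...   | inj₂ (inj₂ (inj₂ (inj₂ iq))) = contradiction (inj₂ (inj₁ (q , x~q , iq))) ¬out

  abstract
    nearSplit : ∀ s → Splitting _~_ _~?_ ~-sym (irrefl G) (Alone s) (Is (near s))
    nearSplit s = splitting _~_ _~?_ ~-sym (irrefl G)
      (λ x → is? (near s) x ×-dec ¬? (outside? s x)) (is? (near s)) proj₁ alone-nbr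

  module NearSplit (s : Bool) = Splitting (nearSplit s)

  Two : V → Set
  Two z = ∃ λ c → ∃ λ c′ → c ≢ c′ × (z ~ c × Is both c) × (z ~ c′ × Is both c′)

  -- By `far-inward` the only way inward is then a single edge to a `both` vertex, shared by the
  -- walks to the two roots.
  FarLone : V → Set
  FarLone z = Is far z × ¬ Next (mid true) z × ¬ Next (mid false) z × ¬ Two z

  abstract
    two? : Decidable Two
    two? z = any? λ c → any? λ c′ → ¬? (c ≟ c′) ×-dec
      ((z ~? c) ×-dec is? both c) ×-dec ((z ~? c′) ×-dec is? both c′)
    farLone? : Decidable FarLone
    farLone? z = is? far z ×-dec ¬? (next? (mid true) z) ×-dec ¬? (next? (mid false) z) ×-dec ¬? (two? z)

  farLone-nbr : ∀ {z} → FarLone z → ∃ λ z′ → z ~ z′ × Is far z′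
  farLone-nbr (iz , ¬t , ¬f , ¬two) with far-inward true iz
  ... | inj₁ nx = contradiction nx ¬t
  ... | inj₂ (c , z~c , ic) with another z~c
  ...   | q , z~q , q≢c with far-nbr iz z~q
  ...     | inj₁ (true , iq)  = contradiction (q , z~q , iq) ¬t
  ...     | inj₁ (false , iq) = contradiction (q , z~q , iq) ¬f
  ...     | inj₂ (inj₁ iq) = contradiction (q , c , q≢c , (z~q , iq) , (z~c , ic)) ¬two
  ...     | inj₂ (inj₂ iq) = q , z~q , iq

  abstract
    farSplit : Splitting _~_ _~?_ ~-sym (irrefl G) FarLone (Is far)
    farSplit = splitting _~_ _~?_ ~-sym (irrefl G) farLone? (is? far) proj₁ farLone-nbr

  module FarSplit = Splitting farSplit

  -- The colouring

  -- An edge from a mid vertex a to the near side gets tint o2 by default, for a walk (o2 , o1) to the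
  -- root. A second walk, to the other root, starts along an edge of tint p2 at a good neighbour
  -- (multi), at a differently tinted neighbour of a (lone), or two steps away (hard). In the hard case
  -- the second edge of that walk may itself have tint o2; then the edges at a get o4 instead.
  data MidView (s : Bool) (a : V) : Set where
    ordinary : Ordinary s a → MidView s a
    multi    : ¬ Ordinary s a → ∀ {g} → a ~ g → Is (near s) g → Good s g →
               ∀ {x} → a ~ x → Is (near s) x → x ≢ g → MidView s a
    lone     : ¬ Ordinary s a → GoodNbr s a → ¬ Several s a → MidView s a
    hard     : ¬ Ordinary s a → ¬ GoodNbr s a → MidView s a

  abstract
    midView : ∀ s a → MidView s a
    midView s a with ordinary? s a | goodNbr? s a | several? s a
    ... | yes o | _     | _      = ordinary o
    ... | no ¬o | no ¬g | _      = hard ¬o ¬g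
    ... | no ¬o | yes g | no ¬m  = lone ¬o g ¬m
    ... | no ¬o | yes (g , a~g , ig , gg) | yes (x , x′ , x≢x′ , (a~x , ix) , (a~x′ , ix′)) with x ≟ g
    ...   | no x≢g   = multi ¬o a~g ig gg a~x ix x≢g
    ...   | yes refl = multi ¬o a~g ig gg a~x′ ix′ (λ e → x≢x′ (≡-sym e))

  tintBy : ∀ {s a} → Tint → MidView s a → V → Tint
  tintBy h (ordinary _) x = o2
  tintBy h (multi _ {g} _ _ _ _ _ _) x = pick (x ≟ g) p2 o2
  tintBy {s} {a} h (lone _ _ _) x = pick (MidSplit.T? s a) o2 p2
  tintBy h (hard _ _) x = h

  -- Breaks a circularity: the tint of a hard vertex depends on tints at its neighbours. The
  -- placeholder `o2` for hard vertices does no harm, since the neighbours consulted in `HardPair`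
  -- have a crossing, hence good, near neighbour and so are not hard (`soft-tint`).
  baseTint : Bool → V → V → Tint
  baseTint s a = tintBy o2 (midView s a)

  Across : Bool → V → V → V → Set
  Across s a a′ x′ = a ~ a′ × Is (mid s) a′ × a′ ~ x′ × Is (near s) x′ × Crossing s x′

  HardPair : Bool → V → Set
  HardPair s a = ∃ λ a′ → ∃ λ x′ → Across s a a′ x′ × baseTint s a′ x′ ≡ o2

  abstract
    hardPair? : ∀ s → Decidable (HardPair s)
    hardPair? s a = any? λ a′ → any? λ x′ →
      ((a ~? a′) ×-dec is? (mid s) a′ ×-dec (a′ ~? x′) ×-dec is? (near s) x′ ×-dec crossing? s x′)
      ×-dec (baseTint s a′ x′ ≟ᵗ o2)

  hardTint : Bool → V → Tint
  hardTint s a = pick (hardPair? s a) o4 o2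

  midTint : Bool → V → V → Tint
  midTint s a = tintBy (hardTint s a) (midView s a)

  -- A vertex with no outside neighbour promises two walks to its own root: along its own root edge,
  -- and over a near neighbour whose root edge has the other of the tints `o1` and `o4`. The
  -- splitting supplies that neighbour.
  nearTint : Bool → V → Tint
  nearTint s x = pick (outside? s x) o1 (pick (NearSplit.T? s x) o1 o4)

  twoSide : ∀ {z} → Dec (Two z) → V → Bool
  twoSide (yes (c₀ , _)) c = pick (c ≟ c₀) false true
  twoSide {z} (no _)     c = pick (FarSplit.T? z) true false

  -- A neighbour of kind `mid s` already serves `root s` with the palette of `s`, so the edge to a
  -- `both` vertex takes the other palette.
  farSide : V → V → Bool
  farSide z c = pick (next? (mid false) z) true (pick (next? (mid true) z) false (twoSide (two? z) c))

  colourBy : Kind → Kind → V → V → Fin 9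
  colourBy (core s) (near s′) p q = paint s′ (nearTint s′ q)
  colourBy (near s) (core s′) p q = paint s (nearTint s p)
  colourBy (near s) (near s′) p q = pick (s ≟ᵇ s′) (paint true o3) (paint true p3)
  colourBy (near s) (mid s′)  p q = paint s′ (midTint s′ q p)
  colourBy (mid s)  (near s′) p q = paint s (midTint s p q)
  colourBy (near s) both      p q = paint s o3
  colourBy both     (near s)  p q = paint s o3
  colourBy (mid s)  (mid s′)  p q = pick (s ≟ᵇ s′) (paint s p4) (paint true p3)
  colourBy (mid s)  both      p q = paint s o3
  colourBy both     (mid s)   p q = paint s o3
  colourBy (mid s)  far       p q = paint s o3
  colourBy far      (mid s)   p q = paint s o3
  colourBy both     far       p q = paint (farSide q p) o2
  colourBy far      both      p q = paint (farSide p q) o2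
  colourBy far      far       p q = paint false o4
  -- This is the reserved colour of the edge between the roots. The other pairs landing here are
  -- non-adjacent or, as for two `both` vertices, lie on none of the walks below.
  colourBy _        _         p q = zero

  colourBy-sym : ∀ k k′ p q → colourBy k k′ p q ≡ colourBy k′ k q p
  colourBy-sym (core _) (core _) p q = refl
  colourBy-sym (core _) (near _) p q = refl
  colourBy-sym (core _) (mid _)  p q = refl
  colourBy-sym (core _) both     p q = refl
  colourBy-sym (core _) far      p q = refl
  colourBy-sym (near _) (core _) p q = refl
  colourBy-sym (near false) (near false) p q = refl
  colourBy-sym (near false) (near true)  p q = refl
  colourBy-sym (near true)  (near false) p q = refl
  colourBy-sym (near true)  (near true)  p q = refl
  colourBy-sym (near _) (mid _)  p q = refl
  colourBy-sym (near _) both     p q = refl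
  colourBy-sym (near _) far      p q = refl
  colourBy-sym (mid _)  (core _) p q = refl
  colourBy-sym (mid _)  (near _) p q = refl
  colourBy-sym (mid false) (mid false) p q = refl
  colourBy-sym (mid false) (mid true)  p q = refl
  colourBy-sym (mid true)  (mid false) p q = refl
  colourBy-sym (mid true)  (mid true)  p q = refl
  colourBy-sym (mid _)  both     p q = refl
  colourBy-sym (mid _)  far      p q = refl
  colourBy-sym both     (core _) p q = refl
  colourBy-sym both     (near _) p q = refl
  colourBy-sym both     (mid _)  p q = refl
  colourBy-sym both     both     p q = refl
  colourBy-sym both     far      p q = refl
  colourBy-sym far      (core _) p q = refl
  colourBy-sym far      (near _) p q = refl
  colourBy-sym far      (mid _)  p q = refl
  colourBy-sym far      both     p q = refl
  colourBy-sym far      far      p q = refl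

  colouring : EdgeColouring G 9
  colouring = record
    { col    = λ p q → colourBy (kind p) (kind q) p q
    ; colSym = λ p q → colourBy-sym (kind p) (kind q) p q }

  colour-at : ∀ {k k′ p q} → Is k p → Is k′ q → col colouring p q ≡ colourBy k k′ p q
  colour-at {p = p} {q} i j = cong₂ (λ k k′ → colourBy k k′ p q) (kind-is i) (kind-is j)

  -- Walks to the two roots

  record Reach (s : Bool) (p : V) (t : Bool) (M : Mask) : Set where
    constructor reach
    field
      walk   : Walk (Adj G) p (root (rel s t))
      unique : Unique (colours colouring walk)
      within : All (_∈ map (paint s) M) (colours colouring walk)

  halt : ∀ {s} → Reach s (root s) true []
  halt = reach [] [] []

  -- Freshness is tested against the mask instead of the walk, so on concrete masks it is settled by
  -- evaluation.
  step : ∀ {s p q t M} k {fresh : False (k ∈ᵗ? M)} → p ~ q → col colouring p q ≡ paint s k →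
         Reach s q t M → Reach s p t (k ∷ M)
  step {s} {p} {q} {M = M} k {fresh} e eq (reach w u i) = reach (e ∷ w) (All.map apart i ∷ u) (here eq ∷ All.map there i)
    where
    apart : ∀ {c} → c ∈ map (paint s) M → col colouring p q ≢ c
    apart j refl with ∈-map⁻ (paint s) j
    ... | l , l∈M , e′ = toWitnessFalse fresh (subst (_∈ M) (paint-injective s (trans (≡-sym e′) eq)) l∈M)

  widen : ∀ {s p t M N} {sub : True (all? (_∈ᵗ? N) M)} → Reach s p t M → Reach s p t N
  widen {s} {sub = sub} (reach w u i) =
    reach w u (All.map (Subset.map⁺ (paint s) (All.lookup (toWitness sub))) i)

  across : ∀ s {p t M} → Reach (not s) p t M → Reach s p (not t) (map opposite M)
  across s {p} {t} {M} r = let w , u , i = moved (rel-not s t) r in reach w u i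
    where
    moved : ∀ {b} → rel (not s) t ≡ b → Reach (not s) p t M →
            Σ (Walk (Adj G) p (root b)) λ w →
              Unique (colours colouring w) × All (_∈ map (paint s) (map opposite M)) (colours colouring w)
    moved refl (reach w u i) =
      w , u , subst (λ cs → All (_∈ cs) _) (trans (map-cong (paint-not s) M) (map-∘ M)) i

  near-own : ∀ {s x} → Is (near s) x → Outside s x → Reach s x true (o1 ∷ [])
  near-own {s} {x} ix@(near nx) out =
    step o1 (~-sym (Near.adj nx))
      (trans (colour-at ix (core s)) (cong (paint s) (pick-yes (outside? s x) out))) halt

  -- The crossing edge has an absolute colour, so its tint depends on `s`. The equation says that
  -- edges within a neighbourhood have the other third tint, hence may precede this walk.
  crossing-opp : ∀ {s x} → Is (near s) x → Crossing s x →
                 ∃ λ b → Reach s x false ((b , 2F) ∷ p1 ∷ []) × paint true o3 ≡ paint s (not b , 2F)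
  crossing-opp {s} {x} ix (y , x~y , iy) = go s refl
    where
    back : Reach s y false (p1 ∷ [])
    back = across s (near-own iy (inj₁ (x , ~-sym x~y , not² {near} ix)))
    colour : col colouring x y ≡ paint true p3
    colour = trans (colour-at ix iy) (pick-no (s ≟ᵇ not s) (not-¬ refl))
    go : ∀ s′ → s ≡ s′ → ∃ λ b → Reach s x false ((b , 2F) ∷ p1 ∷ []) × paint true o3 ≡ paint s (not b , 2F)
    go true  refl = false , step p3 x~y colour back , refl
    go false refl = true , step o3 x~y colour back , refl

  both-own : ∀ {s c} → Is both c → Reach s c true (o3 ∷ o1 ∷ [])
  both-own {s} {c} ic@(both _ t) with t s
  ... | x , c~x , nx = step o3 c~x (colour-at ic (near nx)) (near-own (near nx) (inj₂ (inj₁ (c , ~-sym c~x , ic))))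

  both-opp : ∀ {s c} → Is both c → Reach s c false (p3 ∷ p1 ∷ [])
  both-opp {s} ic = across s (both-own ic)

  exit-opp : ∀ {s x} → Is (near s) x → Crossing s x ⊎ Next both x → Reach s x false (o3 ∷ p3 ∷ p1 ∷ [])
  exit-opp ix (inj₁ cr) with crossing-opp ix cr
  ... | true , r , _  = widen r
  ... | false , r , _ = widen r
  exit-opp ix (inj₂ (c , x~c , ic)) = step o3 x~c (colour-at ix ic) (both-opp ic)

  good-opp : ∀ {s x} → Is (near s) x → Good s x → Reach s x false (o3 ∷ p3 ∷ p1 ∷ [])
  good-opp ix (inj₁ cr) = exit-opp ix (inj₁ cr)
  good-opp ix (inj₂ (inj₁ b)) = exit-opp ix (inj₂ b)
  good-opp {s} {x} ix (inj₂ (inj₂ (x′ , x~x′ , ix′ , cr))) with crossing-opp ix′ cr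
  ... | true , r , e  = widen (step p3 x~x′ (trans (trans (colour-at ix ix′) (pick-yes (s ≟ᵇ s) refl)) e) r)
  ... | false , r , e = widen (step o3 x~x′ (trans (trans (colour-at ix ix′) (pick-yes (s ≟ᵇ s) refl)) e) r)

  -- Walks from the `mid` vertices

  tint-at : ∀ {s a} h (mv : MidView s a) → midView s a ≡ mv → ∀ x → tintBy h (midView s a) x ≡ tintBy h mv x
  tint-at h mv e x = cong (λ v → tintBy h v x) e

  mid-colour : ∀ {s a x k} → Is (mid s) a → Is (near s) x → midTint s a x ≡ k → col colouring a x ≡ paint s k
  mid-colour {s} ia ix e = trans (colour-at ia ix) (cong (paint s) e)

  mid-own : ∀ {s a x k} {fresh : False (k ∈ᵗ? (o1 ∷ []))} → Is (mid s) a → a ~ x → Is (near s) x →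
            midTint s a x ≡ k → Reach s a true (k ∷ o1 ∷ [])
  mid-own {k = k} {fresh} ia a~x ix e =
    step k {fresh} a~x (mid-colour ia ix e) (near-own ix (inj₂ (inj₂ (_ , ~-sym a~x , ia))))

  mid-touch : ∀ {s a} → Is (mid s) a → Next (near s) a
  mid-touch (mid _ (x , a~x , nx) _) = x , a~x , near nx

  module _ {s : Bool} {a : V} where

    ordinary-tint : ∀ h → Ordinary s a → ∀ x → tintBy h (midView s a) x ≡ o2
    ordinary-tint h o x with midView s a
    ... | ordinary _           = refl
    ... | multi ¬o _ _ _ _ _ _ = contradiction o ¬o
    ... | lone ¬o _ _          = contradiction o ¬o
    ... | hard ¬o _            = contradiction o ¬o

    lone-tint : ∀ h → Lone s a → ∀ x → tintBy h (midView s a) x ≡ pick (MidSplit.T? s a) o2 p2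
    lone-tint h (_ , ¬o , gn , ¬sev) x with midView s a
    ... | ordinary o = contradiction o ¬o
    ... | multi _ a~g ig _ a~x ix ne = contradiction (_ , _ , ne , (a~x , ix) , (a~g , ig)) ¬sev
    ... | lone _ _ _ = refl
    ... | hard _ ¬gn = contradiction gn ¬gn

    soft-tint : ∀ h h′ → GoodNbr s a → ∀ x → tintBy h (midView s a) x ≡ tintBy h′ (midView s a) x
    soft-tint h h′ gn x with midView s a
    ... | ordinary _          = refl
    ... | multi _ _ _ _ _ _ _ = refl
    ... | lone _ _ _          = refl
    ... | hard _ ¬gn          = contradiction gn ¬gn

    base-tint : ∀ x → baseTint s a x ≡ o2 ⊎ baseTint s a x ≡ p2
    base-tint x with midView s a
    ... | ordinary _ = inj₁ refl
    ... | hard _ _   = inj₁ refl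
    ... | multi _ {g} _ _ _ _ _ _ with x ≟ g
    ...   | yes _ = inj₂ refl
    ...   | no _  = inj₁ refl
    base-tint x | lone _ _ _ with MidSplit.T? s a
    ...   | yes _ = inj₁ refl
    ...   | no _  = inj₂ refl

  ordinary-own : ∀ {s a} → Is (mid s) a → Ordinary s a → Reach s a true (o2 ∷ o1 ∷ [])
  ordinary-own {s} {a} ia o with mid-touch ia
  ... | x , a~x , ix = mid-own ia a~x ix (ordinary-tint (hardTint s a) o x)

  mid-mid : ∀ {s a a′} → Is (mid s) a → Is (mid s) a′ → col colouring a a′ ≡ paint s p4
  mid-mid {s} i j = trans (colour-at i j) (pick-yes (s ≟ᵇ s) refl)

  leaving-opp : ∀ {s a} → Is (mid s) a → Leaving s a → Reach s a false (o3 ∷ p1 ∷ p2 ∷ p3 ∷ [])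
  leaving-opp ia (inj₁ (c , a~c , ic)) = widen (step o3 a~c (colour-at ia ic) (both-opp ic))
  leaving-opp {s} {a} ia (inj₂ (b , a~b , ib)) = go s refl
    where
    back : Reach s b false (p2 ∷ p1 ∷ [])
    -- The edge back to `a` makes `b` ordinary on its own side.
    back = across s (ordinary-own ib (inj₁ (inj₂ (a , ~-sym a~b , not² {mid} ia))))
    colour : col colouring a b ≡ paint true p3
    colour = trans (colour-at ia ib) (pick-no (s ≟ᵇ not s) (not-¬ refl))
    go : ∀ s′ → s ≡ s′ → Reach s a false (o3 ∷ p1 ∷ p2 ∷ p3 ∷ [])
    go true  refl = widen (step p3 a~b colour back)
    go false refl = widen (step o3 a~b colour back)

  farSide-mid : ∀ s {z} c → Next (mid s) z → ¬ Next (mid (not s)) z → farSide z c ≡ not s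
  farSide-mid true  {z} c m ¬m = trans (pick-no (next? (mid false) z) ¬m) (pick-yes (next? (mid true) z) m)
  farSide-mid false {z} c m ¬m = pick-yes (next? (mid false) z) m

  far-opp : ∀ {s z} → Is far z → Next (mid s) z → Reach s z false (p1 ∷ p2 ∷ p3 ∷ [])
  far-opp {s} {z} iz m with next? (mid (not s)) z
  ... | yes (b , z~b , ib) = widen (step p3 z~b (trans (colour-at iz ib) (paint-not s o3))
                               (across s (ordinary-own ib (inj₂ (inj₁ (z , ~-sym z~b , iz))))))
  ... | no ¬m′ with far-inward (not s) iz
  ...   | inj₁ m′ = contradiction m′ ¬m′
  ...   | inj₂ (c , z~c , ic) =
    widen (step p2 z~c (trans (colour-at iz ic) (trans (cong (λ b → paint b o2) (farSide-mid s c m ¬m′)) (paint-not s o2)))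
            (both-opp ic))

  ordinary-opp : ∀ {s a} → Is (mid s) a → Ordinary s a → Reach s a false (o3 ∷ p1 ∷ p2 ∷ p3 ∷ p4 ∷ [])
  ordinary-opp ia (inj₁ l) = widen (leaving-opp ia l)
  ordinary-opp ia (inj₂ (inj₁ (z , a~z , iz))) =
    widen (step o3 a~z (colour-at ia iz) (far-opp iz (_ , ~-sym a~z , ia)))
  ordinary-opp ia (inj₂ (inj₂ (a′ , a~a′ , ia′ , l))) =
    widen (step p4 a~a′ (mid-mid ia ia′) (leaving-opp ia′ l))

  -- The last field of each constructor is for the near neighbours of `a`: in `outside-opp` such a
  -- neighbour either is good or reaches the opposite root through `a` by an edge of known tint.
  data MidClass (s : Bool) (a : V) : Set where
    I   : Reach s a true (o2 ∷ o1 ∷ []) → Reach s a false (o3 ∷ p1 ∷ p2 ∷ p3 ∷ p4 ∷ []) →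
          (∀ {x} → a ~ x → Is (near s) x → Good s x ⊎ midTint s a x ≡ o2) → MidClass s a
    II  : Reach s a true (p2 ∷ o1 ∷ []) → Reach s a true (p4 ∷ o2 ∷ o4 ∷ o1 ∷ []) →
          Reach s a false (p2 ∷ o3 ∷ p3 ∷ p1 ∷ []) →
          (∀ {x} → a ~ x → Is (near s) x → Good s x) → MidClass s a
    III : Reach s a true (o4 ∷ o1 ∷ []) → Reach s a true (p4 ∷ o2 ∷ o1 ∷ []) →
          Reach s a false (p4 ∷ o2 ∷ o3 ∷ p3 ∷ p1 ∷ []) →
          (∀ {x} → a ~ x → Is (near s) x → midTint s a x ≡ o4) → MidClass s a

  settled-own : ∀ {s a} → Is (mid s) a → MidSplit.T s a ⊎ ¬ Lone s a →
                Reach s a true (o2 ∷ o1 ∷ []) ⊎ Reach s a true (o4 ∷ o1 ∷ [])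
  settled-own {s} {a} ia st = go (midView s a) refl
    where
    go : ∀ mv → midView s a ≡ mv → Reach s a true (o2 ∷ o1 ∷ []) ⊎ Reach s a true (o4 ∷ o1 ∷ [])
    go (ordinary o) _ = inj₁ (ordinary-own ia o)
    go mv@(multi _ {g} _ _ _ {x} a~x ix x≢g) e =
      inj₁ (mid-own ia a~x ix (trans (tint-at _ mv e x) (pick-no (x ≟ g) x≢g)))
    go mv@(lone ¬o gn@(g , a~g , ig , _) ¬sev) e =
      inj₁ (mid-own ia a~g ig (trans (tint-at _ mv e g) (pick-yes (MidSplit.T? s a)
        ([ id , (λ ¬l → contradiction (ia , ¬o , gn , ¬sev) ¬l) ]′ st))))
    go mv@(hard _ _) e with mid-touch ia | hardPair? s a in eq
    ... | x , a~x , ix | yes _ = inj₂ (mid-own ia a~x ix (trans (tint-at _ mv e x) (cong (λ d → pick d o4 o2) eq)))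
    ... | x , a~x , ix | no _  = inj₁ (mid-own ia a~x ix (trans (tint-at _ mv e x) (cong (λ d → pick d o4 o2) eq)))

  -- Take a walk of at most three edges from `a` to any vertex `y` of the opposite neighbourhood. As
  -- `a` is neither ordinary nor next to a good vertex, its inner vertices can only be of kinds
  -- `mid s` and `near s`, in this order.
  hard-across : ∀ {s a} → Is (mid s) a → ¬ Ordinary s a → ¬ GoodNbr s a → ∃ λ a′ → ∃ λ x′ → Across s a a′ x′
  hard-across {s} {a} ia@(mid off _ ¬t) ¬o ¬gn with inhabited (not s)
  ... | y , ny with close a y
  ...   | inj₁ refl = contradiction ny (proj₂ (off (not s)))
  ...   | inj₂ (inj₁ a~y) = contradiction (y , a~y , ny) ¬t
  ...   | inj₂ (inj₂ (inj₁ (p , a~p , p~y))) with mid-nbr ia a~p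
  ...     | inj₁ ip = contradiction (p , a~p , ip , inj₁ (y , p~y , near ny)) ¬gn
  ...     | inj₂ (inj₁ (mid _ _ ¬t′)) = contradiction (y , p~y , ny) ¬t′
  ...     | inj₂ (inj₂ (inj₁ ip)) = contradiction (inj₁ (inj₂ (p , a~p , ip))) ¬o
  ...     | inj₂ (inj₂ (inj₂ (inj₁ ip))) = contradiction (inj₁ (inj₁ (p , a~p , ip))) ¬o
  ...     | inj₂ (inj₂ (inj₂ (inj₂ ip))) = contradiction (inj₂ (inj₁ (p , a~p , ip))) ¬o
  hard-across {s} {a} ia ¬o ¬gn | y , ny | inj₂ (inj₂ (inj₂ (p , q , a~p , p~q , q~y))) with mid-nbr ia a~p
  ... | inj₂ (inj₂ (inj₁ ip)) = contradiction (inj₁ (inj₂ (p , a~p , ip))) ¬o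
  ... | inj₂ (inj₂ (inj₂ (inj₁ ip))) = contradiction (inj₁ (inj₁ (p , a~p , ip))) ¬o
  ... | inj₂ (inj₂ (inj₂ (inj₂ ip))) = contradiction (inj₂ (inj₁ (p , a~p , ip))) ¬o
  ... | inj₁ ip with near-nbr ip p~q
  ...   | inj₁ refl = contradiction (Near.adj ny) (noTriangle s q~y)
  ...   | inj₂ (inj₁ iq) = contradiction (p , a~p , ip , inj₂ (inj₂ (q , p~q , iq , (y , q~y , near ny)))) ¬gn
  ...   | inj₂ (inj₂ (inj₁ iq)) = contradiction (p , a~p , ip , inj₁ (q , p~q , iq)) ¬gn
  ...   | inj₂ (inj₂ (inj₂ (inj₁ (mid _ _ ¬t′)))) = contradiction (y , q~y , ny) ¬t′
  ...   | inj₂ (inj₂ (inj₂ (inj₂ iq))) = contradiction (p , a~p , ip , inj₂ (inj₁ (q , p~q , iq))) ¬gn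
  hard-across {s} {a} ia ¬o ¬gn | y , ny | inj₂ (inj₂ (inj₂ (p , q , a~p , p~q , q~y)))
      | inj₂ (inj₁ ip) with mid-nbr ip p~q
  ...   | inj₁ iq = p , q , a~p , ip , p~q , iq , (y , q~y , near ny)
  ...   | inj₂ (inj₁ (mid _ _ ¬t′)) = contradiction (y , q~y , ny) ¬t′
  ...   | inj₂ (inj₂ (inj₁ iq)) = contradiction (inj₂ (inj₂ (p , a~p , ip , inj₂ (q , p~q , iq)))) ¬o
  ...   | inj₂ (inj₂ (inj₂ (inj₁ iq))) = contradiction (inj₂ (inj₂ (p , a~p , ip , inj₁ (q , p~q , iq)))) ¬o
  ...   | inj₂ (inj₂ (inj₂ (inj₂ (far _ ¬t′)))) = contradiction (y , q~y , ny) (¬t′ (not s))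

  mid-class : ∀ {s a} → Is (mid s) a → MidClass s a
  mid-class {s} {a} ia = go (midView s a) refl
    where
    go : ∀ mv → midView s a ≡ mv → MidClass s a
    go (ordinary o) _ = I (ordinary-own ia o) (ordinary-opp ia o)
      λ {x} _ _ → inj₂ (ordinary-tint (hardTint s a) o x)
    go mv@(multi _ {g} a~g ig gg {x} a~x ix x≢g) e =
      I (mid-own ia a~x ix (trans (tint-at _ mv e x) (pick-no (x ≟ g) x≢g)))
        (widen (step p2 a~g (mid-colour ia ig (trans (tint-at _ mv e g) (pick-yes (g ≟ g) refl))) (good-opp ig gg)))
        λ {y} _ _ → other y
      where
      other : ∀ y → Good s y ⊎ midTint s a y ≡ o2
      other y with y ≟ g in eq
      ... | yes refl = inj₁ gg
      ... | no _     = inj₂ (trans (tint-at _ mv e y) (cong (λ d → pick d p2 o2) eq))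
    go mv@(lone ¬o gn@(g , a~g , ig , gg) ¬sev) e with MidSplit.T? s a in eq
    ... | yes t = first (MidSplit.inner s t)
      where
      tint : ∀ x → midTint s a x ≡ o2
      tint x = trans (tint-at _ mv e x) (cong (λ d → pick d o2 p2) eq)
      first : (∃ λ a′ → a ~ a′ × Lone s a′ × ¬ MidSplit.T s a′) → MidClass s a
      first (a′ , a~a′ , l@(ia′ , _ , (g′ , a′~g′ , ig′ , gg′) , _) , ¬t′) =
        I (mid-own ia a~g ig (tint g))
          -- The opposite root is reached over a lone neighbour outside `T`, whose near edge has
          -- tint `p2` and ends in a good vertex.
          (widen (step p4 a~a′ (mid-mid ia ia′)
            (step p2 a′~g′ (mid-colour ia′ ig′ (trans (lone-tint _ l g′) (pick-no (MidSplit.T? s a′) ¬t′)))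
              (good-opp ig′ gg′))))
          λ {x} _ _ → inj₂ (tint x)
    ... | no ¬t = second (MidSplit.outer s (ia , ¬o , gn , ¬sev) ¬t)
      where
      tint : ∀ x → midTint s a x ≡ p2
      tint x = trans (tint-at _ mv e x) (cong (λ d → pick d o2 p2) eq)
      allGood : ∀ {x} → a ~ x → Is (near s) x → Good s x
      allGood {x} a~x ix with x ≟ g
      ... | yes refl = gg
      ... | no x≢g   = contradiction (x , g , x≢g , (a~x , ix) , (a~g , ig)) ¬sev
      second : (∃ λ a′ → a ~ a′ × Is (mid s) a′ × (MidSplit.T s a′ ⊎ ¬ Lone s a′)) → MidClass s a
      -- Both direct walks start with the same edge of tint `p2`; the detour over `a′` avoids it, so
      -- two vertices of class `midII` on one side can still be joined.
      second (a′ , a~a′ , ia′ , st) = II (mid-own ia a~g ig (tint g)) detour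
        (step p2 a~g (mid-colour ia ig (tint g)) (good-opp ig gg)) allGood
        where
        detour : Reach s a true (p4 ∷ o2 ∷ o4 ∷ o1 ∷ [])
        detour with settled-own ia′ st
        ... | inj₁ r = widen (step p4 a~a′ (mid-mid ia ia′) r)
        ... | inj₂ r = widen (step p4 a~a′ (mid-mid ia ia′) r)
    go mv@(hard ¬o ¬gn) e with hardPair? s a in eq
    -- The walk to the opposite root spends `o2` on the edge from `a′` to `x′`; with `o4` at `a`,
    -- the direct walk to the own root stays disjoint from it.
    ... | yes (a′ , x′ , (a~a′ , ia′ , a′~x′ , ix′ , cr) , base) =
      III (mid-own ia (proj₁ (proj₂ nx)) (proj₂ (proj₂ nx)) (tint _))
          (step p4 a~a′ (mid-mid ia ia′) (mid-own ia′ a′~x′ ix′ tint′))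
          (step p4 a~a′ (mid-mid ia ia′) (step o2 a′~x′ (mid-colour ia′ ix′ tint′) (exit-opp ix′ (inj₁ cr))))
          λ {x} _ _ → tint x
      where
      nx = mid-touch ia
      tint : ∀ x → midTint s a x ≡ o4
      tint x = trans (tint-at _ mv e x) (cong (λ d → pick d o4 o2) eq)
      tint′ : midTint s a′ x′ ≡ o2
      tint′ = trans (soft-tint _ o2 (x′ , a′~x′ , ix′ , inj₁ cr) x′) base
    ... | no ¬pair with hard-across ia ¬o ¬gn
    ...   | a′ , x′ , ac@(a~a′ , ia′ , a′~x′ , ix′ , cr) =
      I (mid-own ia (proj₁ (proj₂ nx)) (proj₂ (proj₂ nx)) (tint _))
        (widen (step p4 a~a′ (mid-mid ia ia′) (step p2 a′~x′ (mid-colour ia′ ix′ tint′) (exit-opp ix′ (inj₁ cr)))))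
        λ {x} _ _ → inj₂ (tint x)
      where
      nx = mid-touch ia
      tint : ∀ x → midTint s a x ≡ o2
      tint x = trans (tint-at _ mv e x) (cong (λ d → pick d o4 o2) eq)
      -- Base tints are `o2` or `p2`, and there is no hard pair with `o2`.
      base : baseTint s a′ x′ ≡ p2
      base = [ (λ b → contradiction (a′ , x′ , ac , b) ¬pair) , id ]′ (base-tint x′)
      tint′ : midTint s a′ x′ ≡ p2
      tint′ = trans (soft-tint _ o2 (x′ , a′~x′ , ix′ , inj₁ cr) x′) base

  -- Every vertex keeps the promises of a class

  Has : Bool → V → Class → Set
  Has s p κ = All (λ (t , M) → Reach s p t M) (caps κ)

  mid-has : ∀ {s a} → Is (mid s) a → ∃ (Has s a)
  mid-has ia with mid-class ia
  ... | I r r′ _      = midI , r ∷ r′ ∷ []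
  ... | II r r′ r″ _  = midII , r ∷ r′ ∷ r″ ∷ []
  ... | III r r′ r″ _ = midIII , r ∷ r′ ∷ r″ ∷ []

  -- The mask is every tint except `o1`: just disjoint from the direct walk of another `nearI`
  -- vertex on the same side.
  outside-opp : ∀ {s x} → Is (near s) x → Outside s x →
                Reach s x false (o2 ∷ o3 ∷ o4 ∷ p1 ∷ p2 ∷ p3 ∷ p4 ∷ [])
  outside-opp ix (inj₁ cr) = widen (exit-opp ix (inj₁ cr))
  outside-opp ix (inj₂ (inj₁ b)) = widen (exit-opp ix (inj₂ b))
  outside-opp {s} {x} ix (inj₂ (inj₂ (a , x~a , ia))) = go (mid-class ia)
    where
    colour : ∀ {k} → midTint s a x ≡ k → col colouring x a ≡ paint s k
    colour e = trans (colSym colouring x a) (mid-colour ia ix e)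
    go : MidClass s a → Reach s x false (o2 ∷ o3 ∷ o4 ∷ p1 ∷ p2 ∷ p3 ∷ p4 ∷ [])
    go (I _ r f) with f (~-sym x~a) ix
    ... | inj₁ gx = widen (good-opp ix gx)
    ... | inj₂ e  = widen (step o2 x~a (colour e) r)
    go (II _ _ _ f) = widen (good-opp ix (f (~-sym x~a) ix))
    go (III _ _ r f) = widen (step o4 x~a (colour (f (~-sym x~a) ix)) r)

  near-root : ∀ {s x k} → Is (near s) x → nearTint s x ≡ k → Reach s x true (k ∷ [])
  near-root {s} {k = k} ix@(near nx) e =
    step k (~-sym (Near.adj nx)) (trans (colour-at ix (core s)) (cong (paint s) e)) halt

  settled-tint : ∀ {s x} → Is (near s) x → NearSplit.T s x ⊎ ¬ Alone s x → nearTint s x ≡ o1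
  settled-tint {s} {x} ix st with outside? s x | st
  ... | yes _ | _        = refl
  ... | no _  | inj₁ t   = pick-yes (NearSplit.T? s x) t
  ... | no ¬o | inj₂ ¬al = contradiction (ix , ¬o) ¬al

  third : ∀ {s p q t M} → False ((true , 2F) ∈ᵗ? M) → False ((false , 2F) ∈ᵗ? M) → p ~ q →
          col colouring p q ≡ paint true o3 → Reach s q t M → ∃ λ b → Reach s p t ((b , 2F) ∷ M)
  third {s} f f′ e eq r with thirdTints s
  ... | true , _ , eq′  = false , step p3 {f′} e (trans eq eq′) r
  ... | false , _ , eq′ = true , step o3 {f} e (trans eq eq′) r

  near-near : ∀ {s x x′} → Is (near s) x → Is (near s) x′ → col colouring x x′ ≡ paint true o3
  near-near {s} i j = trans (colour-at i j) (pick-yes (s ≟ᵇ s) refl)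

  near-has : ∀ {s x} → Is (near s) x → ∃ (Has s x)
  near-has {s} {x} ix with outside? s x in eo
  ... | yes out = nearI , near-own ix out ∷ outside-opp ix out ∷ []
  ... | no ¬out with NearSplit.T? s x
  ...   | yes t = inT (NearSplit.inner s t)
    where
    inT : (∃ λ q → x ~ q × Alone s q × ¬ NearSplit.T s q) → ∃ (Has s x)
    inT (q , x~q , (iq , ¬outq) , ¬tq)
      with third tt tt x~q (near-near ix iq)
             (near-root iq (trans (pick-no (outside? s q) ¬outq) (pick-no (NearSplit.T? s q) ¬tq)))
    ... | b , r = nearT , near-root ix (trans (pick-no (outside? s x) ¬out) (pick-yes (NearSplit.T? s x) t)) ∷ wide b r ∷ []
      where
      wide : ∀ b → Reach s x true ((b , 2F) ∷ o4 ∷ []) → Reach s x true (o3 ∷ p3 ∷ o4 ∷ [])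
      wide true  = widen
      wide false = widen
  ...   | no ¬t = notT (NearSplit.outer s (ix , ¬out) ¬t)
    where
    notT : (∃ λ q → x ~ q × Is (near s) q × (NearSplit.T s q ⊎ ¬ Alone s q)) → ∃ (Has s x)
    notT (q , x~q , iq , st) with third tt tt x~q (near-near ix iq) (near-root iq (settled-tint iq st))
    ... | b , r = nearN , near-root ix (trans (pick-no (outside? s x) ¬out) (pick-no (NearSplit.T? s x) ¬t)) ∷ wide b r ∷ []
      where
      wide : ∀ b → Reach s x true ((b , 2F) ∷ o1 ∷ []) → Reach s x true (o3 ∷ p3 ∷ o1 ∷ [])
      wide true  = widen
      wide false = widen

  far-colour : ∀ {z c b} → Is far z → Is both c → farSide z c ≡ b → col colouring z c ≡ paint b o2
  far-colour iz ic e = trans (colour-at iz ic) (cong (λ b → paint b o2) e)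

  mid-or : ∀ z → (∃ λ s → Next (mid s) z) ⊎ (¬ Next (mid true) z × ¬ Next (mid false) z)
  mid-or z with next? (mid true) z | next? (mid false) z
  ... | yes m | _     = inj₁ (true , m)
  ... | no _  | yes m = inj₁ (false , m)
  ... | no ¬m | no ¬m′ = inj₂ (¬m , ¬m′)

  farSide-two : ∀ {z} c → ¬ Next (mid true) z → ¬ Next (mid false) z → farSide z c ≡ twoSide (two? z) c
  farSide-two {z} c ¬t ¬f = trans (pick-no (next? (mid false) z) ¬f) (pick-no (next? (mid true) z) ¬t)

  far-full : ∀ {z} → Is far z → ¬ FarLone z → ∃ λ s → Has s z far
  far-full {z} iz ¬l with mid-or z
  ... | inj₁ (s , m@(a , z~a , ia)) =
    s , widen (step o3 z~a (colour-at iz ia) (ordinary-own ia (inj₂ (inj₁ (z , ~-sym z~a , iz))))) ∷ far-opp iz m ∷ []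
  ... | inj₂ (¬t , ¬f) with two? z in eq
  ...   | no ¬two = contradiction (iz , ¬t , ¬f , ¬two) ¬l
  ...   | yes (c , c′ , c≢c′ , (z~c , ic) , (z~c′ , ic′)) =
    true , widen (step o2 z~c′ (far-colour iz ic′ side′) (both-own ic′))
         ∷ widen (step p2 z~c (far-colour iz ic side) (both-opp ic)) ∷ []
    where
    side : farSide z c ≡ false
    side = trans (farSide-two c ¬t ¬f) (trans (cong (λ d → twoSide d c) eq) (pick-yes (c ≟ c) refl))
    side′ : farSide z c′ ≡ true
    side′ = trans (farSide-two c′ ¬t ¬f) (trans (cong (λ d → twoSide d c′) eq) (pick-no (c′ ≟ c) (c≢c′ ∘ ≡-sym)))

  -- The single edge inward has the palette chosen by the splitting, and `z` is assigned to that
  -- side; both walks begin with this edge, as `o2`.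
  far-lone : ∀ {z} b → FarLone z → pick (FarSplit.T? z) true false ≡ b →
             Reach b z true (o1 ∷ o2 ∷ o3 ∷ []) × Reach b z false (o2 ∷ p3 ∷ p1 ∷ [])
  far-lone {z} b (iz , ¬t , ¬f , ¬two) e with far-inward true iz
  ... | inj₁ m = contradiction m ¬t
  ... | inj₂ (c , z~c , ic) = widen (step o2 z~c colour (both-own ic)) , step o2 z~c colour (both-opp ic)
    where
    twoSide-no : (d : Dec (Two z)) → twoSide d c ≡ pick (FarSplit.T? z) true false
    twoSide-no (yes two) = contradiction two ¬two
    twoSide-no (no _)    = refl
    colour : col colouring z c ≡ paint b o2
    colour = far-colour iz ic (trans (farSide-two c ¬t ¬f) (trans (twoSide-no (two? z)) e))

  far-far : ∀ {z z′} → Is far z → Is far z′ → col colouring z z′ ≡ paint false o4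
  far-far i j = colour-at i j

  far-has : ∀ {z} → Is far z → ∃ λ s → ∃ (Has s z)
  far-has {z} iz with farLone? z
  ... | no ¬l with far-full iz ¬l
  ...   | s , h = s , far , h
  far-has {z} iz | yes l with FarSplit.T? z in eq
  ... | yes t with FarSplit.inner t
  ...   | q , z~q , lq@(iq , _) , ¬tq with far-lone true l (cong (λ d → pick d true false) eq)
  ...     | own , opp = true , farLone′ , own
            -- The colour `paint false o4` of edges among far vertices is `p4` from side `true` and
            -- `o4` from side `false`, which is why there are two classes of lone far vertices.
            ∷ step p4 z~q (far-far iz iq) (across true (proj₁ (far-lone false lq (pick-no (FarSplit.T? q) ¬tq))))
            ∷ opp ∷ []
  far-has {z} iz | yes l | no ¬t with FarSplit.outer l ¬t
  ... | q , z~q , iq , st with far-lone false l (cong (λ d → pick d true false) eq)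
  ...   | own , opp = false , farLone , own ∷ step o4 z~q (far-far iz iq) (back (farLone? q) st) ∷ opp ∷ []
    where
    back : Dec (FarLone q) → FarSplit.T q ⊎ ¬ FarLone q → Reach false q false (p1 ∷ p2 ∷ p3 ∷ [])
    back _ (inj₁ tq) = across false (proj₁ (far-lone true (FarSplit.T⊆L tq) (pick-yes (FarSplit.T? q) tq)))
    -- `q` may be assigned to either side; in each case one of its two walks ends at `root true` in
    -- the palette of that side.
    back _ (inj₂ ¬l′) with far-full iq ¬l′
    ... | false , _ ∷ r ∷ [] = r
    ... | true , r ∷ _       = across false r

  has : ∀ p → ∃ λ s → ∃ (Has s p)
  has p with kindOf p
  ... | _ , core s = s , atRoot , halt ∷ []
  ... | _ , near x = _ , near-has (near x)
  ... | _ , mid {s} o t t′ = s , mid-has (mid o t t′)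
  ... | _ , both o t = true , both , both-own (both o t) ∷ both-opp (both o t) ∷ []
  ... | _ , far o t = far-has (far o t)

  -- Joining two vertices through the roots

  bridge : ∀ s t t′ → t ≡ t′ ⊎ root (rel s t) ~ root (rel s t′)
  bridge s true  true  = inj₁ refl
  bridge s true  false = inj₂ (root~ s)
  bridge s false true  = inj₂ (~-sym (root~ s))
  bridge s false false = inj₁ refl

  meet : ∀ {s x y t t′ M M′} → Reach s x t M → Reach s y t′ M′ → All (_∉ M′) M →
         Σ (Walk (Adj G) x y) λ w → Unique (colours colouring w)
  meet {s} {t = t} {t′} {M} {M′} (reach w u i) (reach w′ u′ i′) d = go (bridge s t t′)
    where
    back : Walk (Adj G) (root (rel s t′)) _
    back = backwards colouring w′ []
    back≡ : colours colouring back ≡ colours colouring w′ ʳ++ []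
    back≡ = colours-backwards colouring w′ []
    back-unique : Unique (colours colouring back)
    back-unique = subst Unique (≡-sym back≡) (unique-ʳ++ u′ [] λ { (_ , ()) })
    back-within : All (_∈ map (paint s) M′) (colours colouring back)
    back-within = subst (All _) (≡-sym back≡) (all-ʳ++ i′ [])
    apart : Disjoint (colours colouring w) (colours colouring back)
    apart (j , j′) with ∈-map⁻ (paint s) (All.lookup i j) | ∈-map⁻ (paint s) (All.lookup back-within j′)
    ... | k , k∈M , refl | k′ , k′∈M′ , e =
      All.lookup d k∈M (subst (_∈ M′) (≡-sym (paint-injective s e)) k′∈M′)
    nonzero : ∀ {N cs} → All (_∈ map (paint s) N) cs → zero ∉ cs
    nonzero a j with ∈-map⁻ (paint s) (All.lookup a j)
    ... | _ , _ , ()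
    go : t ≡ t′ ⊎ root (rel s t) ~ root (rel s t′) → Σ (Walk (Adj G) _ _) λ w → Unique (colours colouring w)
    go (inj₁ refl) = _⧺_ colouring w back ,
      subst Unique (≡-sym (colours-⧺ colouring w back)) (++⁺ u back-unique apart)
    go (inj₂ e) = _⧺_ colouring w (e ∷ back) ,
      subst Unique (≡-sym (colours-⧺ colouring w (e ∷ back)))
        (++⁺ u (All.¬Any⇒All¬ _ (λ j → nonzero back-within (subst (_∈ _) zero≡ j)) ∷ back-unique)
          λ { (j , here refl) → nonzero i (subst (_∈ _) zero≡ j) ; (j , there j′) → apart (j , j′) })
      where
      zero≡ : col colouring (root (rel s t)) (root (rel s t′)) ≡ zero
      zero≡ = colour-at (core (rel s t)) (core (rel s t′))

  rainbow : RainbowConnected colouring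
  rainbow x y _ with has x | has y
  ... | s , κ , h | s′ , κ′ , h′ = go (sides s s′)
    where
    join-up : ∀ b → All (λ (t , M) → Reach s y t M) (map (fromSide b) (caps κ′)) →
              Σ (Walk (Adj G) x y) (IsRainbowPath colouring)
    join-up b hs with find (compatible b κ κ′)
    ... | c , c∈ , any with find any
    ...   | d , d∈ , apart with meet (All.lookup h c∈) (All.lookup hs d∈) apart
    ...     | w , u = rainbowPath colouring w u
    go : s ≡ s′ ⊎ s′ ≡ not s → Σ (Walk (Adj G) x y) (IsRainbowPath colouring)
    go (inj₁ refl) = join-up true (All.map⁺ h′)
    go (inj₂ refl) = join-up false (All.map⁺ (All.map (across s) h′))

-- What the diameter and bridgelessness provide

module _ {n : ℕ} (G : Graph n) (dist : ∀ x y → ∃[ k ] (IsDist G x y k × k ≤ 3)) where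

  -- Distances decide adjacency: next to a shortest path with two or more edges, an edge would be a
  -- shorter path.
  adj? : ∀ x y → Dec (Adj G x y)
  adj? x y with dist x y
  ... | _ , (([] , _ , _) , _) , _            = no (irrefl G)
  ... | _ , ((e ∷ [] , _ , _) , _) , _        = yes e
  ... | _ , ((_ ∷ _ ∷ _ , _ , refl) , min) , _ = no λ e →
    contradiction (min (e ∷ []) (((λ { refl → irrefl G e }) ∷ []) ∷ [] ∷ [])) λ { (s≤s ()) }

  within3 : ∀ x y → x ≡ y ⊎ Adj G x y ⊎ (∃ λ p → Adj G x p × Adj G p y) ⊎
                    ∃ λ p → ∃ λ q → Adj G x p × Adj G p q × Adj G q y
  within3 x y with dist x y
  ... | _ , (([] , _ , _) , _) , _                = inj₁ refl
  ... | _ , ((e ∷ [] , _ , _) , _) , _            = inj₂ (inj₁ e)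
  ... | _ , ((e ∷ f ∷ [] , _ , _) , _) , _        = inj₂ (inj₂ (inj₁ (_ , e , f)))
  ... | _ , ((e ∷ f ∷ g ∷ [] , _ , _) , _) , _    = inj₂ (inj₂ (inj₂ (_ , _ , e , f , g)))
  ... | _ , ((_ ∷ _ ∷ _ ∷ _ ∷ _ , _ , refl) , _) , s≤s (s≤s (s≤s ()))

-- A path from `p` to `q` that survives the deletion of the edge leaves `p` along a different edge.
another-neighbour : ∀ {n} (G : Graph n) → Bridgeless G →
                    ∀ {p q} → Adj G p q → ∃ λ r → Adj G p r × r ≢ q
another-neighbour G (_ , cut) {p} {q} e with cut p q e p q
... | [] , _              = contradiction e (irrefl G)
... | (f , kept) ∷ _ , _  = _ , f , λ r≡q → kept (inj₁ (refl , r≡q))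

theorem5 : ∀ {n : ℕ} (G : Graph n) → Bridgeless G → Diam G 3 → NoTriangleEdge G → rc≤ G 9
theorem5 {n} G bridgeless (dist , _) (u , v , u~v , lonely) = colouring , rainbow
  where
  ends : Bool → Fin n
  ends false = u
  ends true  = v
  ends~ : ∀ s → Adj G (ends s) (ends (not s))
  ends~ false = u~v
  ends~ true  = Graph.sym G u~v
  noTriangle : ∀ s {w} → Adj G (ends s) w → ¬ Adj G (ends (not s)) w
  noTriangle false e f = lonely (_ , e , f)
  noTriangle true  e f = lonely (_ , f , e)
  open Frame G (adj? G dist) (within3 G dist) (another-neighbour G bridgeless) ends ends~ noTriangle
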